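{- Let $G$ be a finite group of order $n$ with identity $e$, and let $S\subseteq G\setminus\{e\}$ satisfy $S=S^{ -1}$, $G=\langle S\rangle$ and $|S|=n-3$. Then $\gamma_{S}(\mathrm{Cay}(S:G))=3$ if $n$ is odd, and $\gamma_{S}(\mathrm{Cay}(S:G))=4$ if $n$ is even.
   Context: $\mathrm{Cay}(S:G)$ is the simple graph with vertex set $G$ in which $a$ and $b$ are adjacent if and only if $ab^{ -1}\in S$. For a graph $\Gamma$, $N[v]$ denotes the closed neighborhood of $v$ (the vertex $v$ together with all its neighbors). A signed dominating function of $\Gamma$ is a function $g:V(\Gamma)\to\{ -1,1\}$ with $\sum_{u\in N[v]}g(u)>0$ for every $v\in V(\Gamma)$; its weight is $\sum_{v\in V(\Gamma)}g(v)$. The signed domination number $\gamma_{S}(\Gamma)$ is the minimum weight of a signed dominating function of $\Gamma$ (the subscript $S$ in $\gamma_S$ is part of the notation and unrelated to the set $S$). -}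

module Defs where

open import Algebra.Bundles using (Group)
import Algebra.Properties.Group as GroupProperties
import Algebra.Properties.Monoid.Sum as MonoidSum
open import Data.Bool.Base using (if_then_else_)
open import Data.Fin.Base using (Fin)
import Data.Fin.Properties as Fin
open import Data.Integer.Base using (ℤ; 0ℤ; _◃_; _≤_; _<_)
import Data.Integer.Properties as ℤ
open import Data.Nat.Base using (ℕ)
open import Data.Product.Base using (Σ; ∃; _×_; _,_; proj₁; proj₂)
open import Data.Sign.Base using (Sign)
open import Data.Sum.Base using (_⊎_)
open import Function.Bundles using (Func; Inverse)
open import Function.Properties.Inverse using (Inverse⇒Injection)
open import Level using (Level; _⊔_; suc)
open import Relation.Binary.Bundles using (Setoid)
open import Relation.Binary.Core using (Rel)
import Relation.Binary.Construct.On as On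
open import Relation.Binary.Definitions
  using (Decidable; Irreflexive; Symmetric; _Respects_; _Respects₂_)
import Relation.Binary.PropositionalEquality as ≡
open import Relation.Nullary.Decidable
  using (Dec; does; map′; via-injection; _⊎-dec_)
open import Relation.Unary using (Pred; _∈_; _∉_; _≐_)
import Relation.Unary as Unary

open MonoidSum ℤ.+-0-monoid using (sum)

private
  variable
    a ℓ p : Level

infix 4 _HasCardinality_

_HasCardinality_ : Setoid a ℓ → ℕ → Set (a ⊔ ℓ)
A HasCardinality n = Inverse A (≡.setoid (Fin n))

-- A subset of a setoid is a predicate that respects the equality; as a type
-- its elements are compared by the ambient equality, ignoring the membership
-- proofs, so that `subsetoid A S HasCardinality k` says |S| = k.
subsetoid : (A : Setoid a ℓ) → Pred (Setoid.Carrier A) p → Setoid (a ⊔ p) ℓ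
subsetoid A S = On.setoid {B = Σ (Setoid.Carrier A) S} A proj₁

-- Enumerated setoids have decidable equality, and enumerated subsets of them
-- have decidable membership; hence neither is assumed for groups and
-- connection sets below.
module _ (A : Setoid a ℓ) {n : ℕ} (|A|≡n : A HasCardinality n) where
  open Setoid A

  enumerated⇒≈-decidable : Decidable _≈_
  enumerated⇒≈-decidable =
    via-injection (Inverse⇒Injection |A|≡n) Fin._≟_

  enumerated⇒∈-decidable : {S : Pred Carrier p} → S Respects _≈_ →
    {k : ℕ} → subsetoid A S HasCardinality k → Unary.Decidable S
  enumerated⇒∈-decidable {S = S} resp |S|≡k x =
    map′ (λ (i , eq) → resp eq (proj₂ (from i)))
         (λ x∈S → to (x , x∈S) , strictlyInverseʳ (x , x∈S))
         (Fin.any? λ i → enumerated⇒≈-decidable (proj₁ (from i)) x)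
    where open Inverse |S|≡k

record FiniteSimpleGraph (c ℓ p : Level) : Set (suc (c ⊔ ℓ ⊔ p)) where
  field
    V : Setoid c ℓ

  open Setoid V public using (_≈_) renaming (Carrier to Vertex)

  field
    order         : ℕ
    enumeration   : V HasCardinality order
    Adj           : Rel Vertex p
    Adj-resp-≈    : Adj Respects₂ _≈_
    Adj-sym       : Symmetric Adj
    Adj-irrefl    : Irreflexive _≈_ Adj
    Adj-decidable : Decidable Adj

  N[_] : Vertex → Pred Vertex (ℓ ⊔ p)
  N[ v ] u = u ≈ v ⊎ Adj v u

  _∈N[_]? : ∀ u v → Dec (u ∈ N[ v ])
  u ∈N[ v ]? = enumerated⇒≈-decidable V enumeration u v ⊎-dec Adj-decidable v u

  -- A function V → {-1, 1}; the sign s stands for the integer s ◃ 1.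
  SignFunction : Set (c ⊔ ℓ)
  SignFunction = Func V (≡.setoid Sign)

  value : SignFunction → Vertex → ℤ
  value g v = Func.to g v ◃ 1

  weight : SignFunction → ℤ
  weight g = sum λ i → value g (Inverse.from enumeration i)

  closedNeighbourhoodSum : SignFunction → Vertex → ℤ
  closedNeighbourhoodSum g v = sum λ i →
    let u = Inverse.from enumeration i in
    if does (u ∈N[ v ]?) then value g u else 0ℤ

  IsSignedDominating : SignFunction → Set c
  IsSignedDominating g = ∀ v → 0ℤ < closedNeighbourhoodSum g v

-- The minimum weight of a signed dominating function of Γ is k, i.e. γ_S(Γ) = k:
-- k is attained and is a lower bound.
IsSignedDominationNumber : ∀ {c ℓ p} → FiniteSimpleGraph c ℓ p → ℤ → Set (c ⊔ ℓ)
IsSignedDominationNumber Γ k =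
    (∃ λ g → IsSignedDominating g × weight g ≡.≡ k)
  × (∀ g → IsSignedDominating g → k ≤ weight g)
  where open FiniteSimpleGraph Γ

module _ {c ℓ} (G : Group c ℓ) where
  open Group G

  data ⟨_⟩ {p} (S : Pred Carrier p) : Pred Carrier (c ⊔ ℓ ⊔ p) where
    gen  : ∀ {x} → x ∈ S → x ∈ ⟨ S ⟩
    unit : ε ∈ ⟨ S ⟩
    mul  : ∀ {x y} → x ∈ ⟨ S ⟩ → y ∈ ⟨ S ⟩ → x ∙ y ∈ ⟨ S ⟩
    inv  : ∀ {x} → x ∈ ⟨ S ⟩ → x ⁻¹ ∈ ⟨ S ⟩
    resp : ∀ {x y} → x ≈ y → x ∈ ⟨ S ⟩ → y ∈ ⟨ S ⟩

  Generates : Pred Carrier p → Set _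
  Generates S = ∀ x → x ∈ ⟨ S ⟩

  inverseSet : Pred Carrier p → Pred Carrier p
  inverseSet S x = x ⁻¹ ∈ S

  Cay : {n k : ℕ} → setoid HasCardinality n →
        (S : Pred Carrier p) → S Respects _≈_ → ε ∉ S → S ≐ inverseSet S →
        subsetoid setoid S HasCardinality k → FiniteSimpleGraph c ℓ p
  Cay {n = n} |G|≡n S S-resp ε∉S S≐S⁻¹ |S|≡k = record
    { V             = setoid
    ; order         = n
    ; enumeration   = |G|≡n
    ; Adj           = λ a b → a ∙ b ⁻¹ ∈ S
    ; Adj-resp-≈    = (λ y≈z → S-resp (∙-congˡ (⁻¹-cong y≈z)))
                    , (λ y≈z → S-resp (∙-congʳ y≈z))
    ; Adj-sym       = λ {a} {b} ab⁻¹∈S →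
        S-resp (⁻¹-anti-homo-// a b)
               (proj₁ S≐S⁻¹ ab⁻¹∈S)
    ; Adj-irrefl    = λ {a} {b} a≈b ab⁻¹∈S →
        ε∉S (S-resp (trans (∙-congʳ a≈b) (inverseʳ b)) ab⁻¹∈S)
    ; Adj-decidable = λ a b →
        enumerated⇒∈-decidable setoid |G|≡n S-resp |S|≡k (a ∙ b ⁻¹)
    }
    where open GroupProperties G

{-# OPTIONS --safe #-}
-- Let P be the number of vertices with sign +, let d = n - 2 be the common size
-- of the closed neighbourhoods, and let m v be the number of + signs among the
-- two vertices outside N[v].  The sum over N[v] is 2 (P - m v) - d, and since
-- every vertex lies outside exactly two closed neighbourhoods, Σ_v m v = 2 P.
-- If 2 P ≤ n + 2, positivity forces m v ≤ 1 for every v, so 2 P ≤ n by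
-- averaging; then positivity forces m v = 0, so P = 0, which is absurd.  Hence
-- the weight 2 P - n is at least 3, and it has the parity of n.  Conversely
-- m v ≤ 2, so every sign function of weight at least 3 is dominating.
module Submission where

open import Defs
open import Algebra.Bundles using (AbelianGroup; Group)
import Algebra.Properties.Group as GroupProperties
import Algebra.Properties.Monoid.Sum as MonoidSum
import Algebra.Properties.Semiring.Sum as SemiringSum
open import Data.Bool.Base using (Bool; true; false; not; if_then_else_)
open import Data.Fin.Base using (Fin; zero; suc)
import Data.Fin.Properties as Fin
open import Data.Integer.Base as ℤ using (+_; 0ℤ; _◃_)
import Data.Integer.Properties as ℤ
import Data.Integer.Tactic.RingSolver as ℤSolver
open import Data.Nat.Base
  using (ℕ; zero; suc; _+_; _*_; _≤_; _<_; z≤n; s≤s; s≤s⁻¹)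
open import Data.Nat.Divisibility
  using (_∣_; _∤_; divides; _∣?_; ∣m∣n⇒∣m+n; ∣-refl; _∣0)
import Data.Nat.Properties as ℕ
import Data.Nat.Tactic.RingSolver as ℕSolver
open import Data.Product.Base using (_×_; _,_; proj₁; proj₂; ∃)
open import Data.Sign.Base as Sign using (Sign)
open import Data.Sum.Base using (_⊎_; inj₁; inj₂; [_,_]′)
open import Function.Base using (_∘_)
open import Function.Bundles using (Func; Inverse; mk⇔)
open import Function.Definitions using (Injective)
open import Relation.Binary.Bundles using (module Setoid)
open import Relation.Binary.Definitions using (_Respects_)
open import Relation.Binary.PropositionalEquality
  using (_≡_; refl; sym; trans; cong; cong₂; subst; subst₂; module ≡-Reasoning)
open import Relation.Nullary.Decidable
  using (Dec; does; yes; no; does-⇔; dec-false; from-no)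
open import Relation.Nullary.Negation using (contradiction)
open import Relation.Unary using (Pred; _∈_; _∉_; _≐_)

open SemiringSum ℕ.+-*-semiring
  using (sum; sum-syntax; sum-cong-≗; sum-replicate-zero; ∑-comm; ∑-distrib-+;
         *-distribˡ-sum; *-distribʳ-sum)
open MonoidSum ℤ.+-0-monoid using () renaming (sum to sumℤ)

-- Integer cancellation and finite sums of naturals.

+-cancelʳ-<ℤ : ∀ {i j} k → i ℤ.+ k ℤ.< j ℤ.+ k → i ℤ.< j
+-cancelʳ-<ℤ k i+k<j+k =
  ℤ.≰⇒> λ j≤i → ℤ.<⇒≱ i+k<j+k (ℤ.+-monoˡ-≤ k j≤i)

+-cancelʳ-≤ℤ : ∀ {i j} k → i ℤ.+ k ℤ.≤ j ℤ.+ k → i ℤ.≤ j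
+-cancelʳ-≤ℤ k i+k≤j+k =
  ℤ.≮⇒≥ λ j<i → ℤ.≤⇒≯ i+k≤j+k (ℤ.+-monoˡ-< k j<i)

sum-mono-≤ : ∀ {n} {f g : Fin n → ℕ} → (∀ i → f i ≤ g i) → sum f ≤ sum g
sum-mono-≤ {zero}  f≤g = z≤n
sum-mono-≤ {suc n} f≤g = ℕ.+-mono-≤ (f≤g zero) (sum-mono-≤ (f≤g ∘ suc))

sum-const : ∀ n c → ∑[ i < n ] c ≡ n * c
sum-const zero    c = refl
sum-const (suc n) c = cong (_+_ c) (sum-const n c)

-- Counting with indicator sums.

𝟙 : Bool → ℕ
𝟙 true  = 1
𝟙 false = 0

𝟙-complement : ∀ b → 𝟙 b + 𝟙 (not b) ≡ 1
𝟙-complement true  = refl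
𝟙-complement false = refl

sum-𝟙-≡ : ∀ {n} (j : Fin n) → ∑[ i < n ] 𝟙 (does (i Fin.≟ j)) ≡ 1
sum-𝟙-≡ {suc n} zero    = cong suc (sum-replicate-zero n)
sum-𝟙-≡ {suc n} (suc j) = sum-𝟙-≡ j

module _ {m n} (f : Fin m → Fin n) (f-injective : Injective _≡_ _≡_ f)
         {ℓ} {P : Pred (Fin n) ℓ} (P? : ∀ j → Dec (P j))
         (image : ∀ i → P (f i)) (preimage : ∀ {j} → P j → ∃ λ i → f i ≡ j) where

  private
    -- Injectivity of `f` leaves exactly one index over a `j` in `P`, and `image` leaves none over
    -- any other `j`. Exchanging sums then counts `P` through its parametrisation.
    fibre : ∀ j → 𝟙 (does (P? j)) ≡ ∑[ i < m ] 𝟙 (does (j Fin.≟ f i))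
    fibre j with P? j
    ... | yes Pj with i₀ , refl ← preimage Pj = sym (trans
      (sum-cong-≗ λ i → cong 𝟙 (does-⇔
        (mk⇔ (sym ∘ f-injective) (cong f ∘ sym)) (f i₀ Fin.≟ f i) (i Fin.≟ i₀)))
      (sum-𝟙-≡ i₀))
    ... | no ¬Pj = sym (trans
      (sum-cong-≗ λ i → cong 𝟙 (dec-false (j Fin.≟ f i) λ { refl → ¬Pj (image i) }))
      (sum-replicate-zero m))

  count-image : ∑[ j < n ] 𝟙 (does (P? j)) ≡ m
  count-image = begin
    ∑[ j < n ] 𝟙 (does (P? j))                      ≡⟨ sum-cong-≗ fibre ⟩
    ∑[ j < n ] ∑[ i < m ] 𝟙 (does (j Fin.≟ f i))    ≡⟨ ∑-comm (λ j i → 𝟙 (does (j Fin.≟ f i))) ⟩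
    ∑[ i < m ] ∑[ j < n ] 𝟙 (does (j Fin.≟ f i))    ≡⟨ sum-cong-≗ (λ i → sum-𝟙-≡ (f i)) ⟩
    ∑[ i < m ] 1                                    ≡⟨ sum-const m 1 ⟩
    m * 1                                           ≡⟨ ℕ.*-identityʳ m ⟩
    m                                               ∎
    where open ≡-Reasoning

-- From signed sums to counts of plus signs.

[_]⁺ : Sign → ℕ
[ Sign.+ ]⁺ = 1
[ Sign.- ]⁺ = 0

-- Adding 1 to a sign gives 2 or 0, so adding the number of selected indices leaves twice the number
-- of selected plus signs. Weights and neighbourhood sums can then be estimated in `ℕ`.
signedSum : ∀ {n} (b : Fin n → Bool) (s : Fin n → Sign) →
  sumℤ (λ i → if b i then s i ◃ 1 else 0ℤ) ℤ.+ + (∑[ i < n ] 𝟙 (b i))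
    ≡ + (2 * ∑[ i < n ] (𝟙 (b i) * [ s i ]⁺))
signedSum {zero}  b s = refl
signedSum {suc n} b s = begin
  (x ℤ.+ X) ℤ.+ (+ y ℤ.+ + Y)  ≡⟨ interchange x X (+ y) (+ Y) ⟩
  (x ℤ.+ + y) ℤ.+ (X ℤ.+ + Y)  ≡⟨ cong₂ ℤ._+_ (term (b zero) (s zero)) (signedSum (b ∘ suc) (s ∘ suc)) ⟩
  + (2 * z + 2 * Z)            ≡⟨ cong +_ (ℕ.*-distribˡ-+ 2 z Z) ⟨
  + (2 * (z + Z))              ∎
  where
  open ≡-Reasoning
  x = if b zero then s zero ◃ 1 else 0ℤ
  X = sumℤ (λ i → if b (suc i) then s (suc i) ◃ 1 else 0ℤ)
  y = 𝟙 (b zero)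
  Y = ∑[ i < n ] 𝟙 (b (suc i))
  z = 𝟙 (b zero) * [ s zero ]⁺
  Z = ∑[ i < n ] (𝟙 (b (suc i)) * [ s (suc i) ]⁺)

  interchange : ∀ i j k l → (i ℤ.+ j) ℤ.+ (k ℤ.+ l) ≡ (i ℤ.+ k) ℤ.+ (j ℤ.+ l)
  interchange = ℤSolver.solve-∀

  term : ∀ c t → (if c then t ◃ 1 else 0ℤ) ℤ.+ + 𝟙 c ≡ + (2 * (𝟙 c * [ t ]⁺))
  term true  Sign.+ = refl
  term true  Sign.- = refl
  term false _      = refl

firstPlus : ∀ {n} → ℕ → Fin n → Sign
firstPlus zero    _       = Sign.-
firstPlus (suc m) zero    = Sign.+
firstPlus (suc m) (suc i) = firstPlus m i

sum-firstPlus : ∀ {m n} → m ≤ n → ∑[ i < n ] [ firstPlus m i ]⁺ ≡ m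
sum-firstPlus {n = n} z≤n = sum-replicate-zero n
sum-firstPlus (s≤s m≤n)   = cong suc (sum-firstPlus m≤n)

-- Sign functions on a finite graph.

module _ {c ℓ p} (Γ : FiniteSimpleGraph c ℓ p) where
  open FiniteSimpleGraph Γ
  open Inverse enumeration using (to; from; to-cong; strictlyInverseˡ; strictlyInverseʳ)
  private module V = Setoid V

  inN : Vertex → Fin order → Bool
  inN v i = does (from i ∈N[ v ]?)

  -- Lets the double count in `sum-outsidePlus` trade column sums for row sums.
  inN-sym : ∀ i j → inN (from i) j ≡ inN (from j) i
  inN-sym i j = does-⇔ (mk⇔ swap swap) (from j ∈N[ from i ]?) (from i ∈N[ from j ]?)
    where
    swap : ∀ {u v} → u ∈ N[ v ] → v ∈ N[ u ]
    swap = [ inj₁ ∘ V.sym , inj₂ ∘ Adj-sym ]′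

  plusCount : SignFunction → ℕ
  plusCount g = ∑[ i < order ] [ Func.to g (from i) ]⁺

  weight-plusCount : ∀ g → weight g ℤ.+ + order ≡ + (2 * plusCount g)
  weight-plusCount g = begin
    weight g ℤ.+ + order
      ≡⟨ cong (λ z → weight g ℤ.+ + z) (trans (sum-const order 1) (ℕ.*-identityʳ order)) ⟨
    weight g ℤ.+ + (∑[ i < order ] 1)
      ≡⟨ signedSum (λ _ → true) (λ i → Func.to g (from i)) ⟩
    + (2 * ∑[ i < order ] (1 * [ Func.to g (from i) ]⁺))
      ≡⟨ cong (λ z → + (2 * z)) (sum-cong-≗ λ i → ℕ.*-identityˡ [ Func.to g (from i) ]⁺) ⟩
    + (2 * plusCount g) ∎
    where open ≡-Reasoning

  -- Signs are assigned through the index in the enumeration, so the function respects vertex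
  -- equality.
  ∃-plusCount : ∀ {m} → m ≤ order → ∃ λ g → plusCount g ≡ m
  ∃-plusCount {m} m≤n =
    record { to = firstPlus m ∘ to ; cong = cong (firstPlus m) ∘ to-cong } ,
    trans (sum-cong-≗ λ i → cong ([_]⁺ ∘ firstPlus m) (strictlyInverseˡ i))
          (sum-firstPlus m≤n)

  -- Graphs in which every closed neighbourhood omits two vertices.

  module CoTwoRegular {d} (d+2≡n : d + 2 ≡ order)
    (regular : ∀ v → ∑[ i < order ] 𝟙 (inN v i) ≡ d) where

    co-regular : ∀ v → ∑[ i < order ] 𝟙 (not (inN v i)) ≡ 2
    co-regular v = ℕ.+-cancelˡ-≡ d _ _ (begin
      d + ∑[ i < order ] 𝟙 (not (inN v i))
        ≡⟨ cong (_+ ∑[ i < order ] 𝟙 (not (inN v i))) (regular v) ⟨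
      ∑[ i < order ] 𝟙 (inN v i) + ∑[ i < order ] 𝟙 (not (inN v i))
        ≡⟨ ∑-distrib-+ (𝟙 ∘ inN v) (𝟙 ∘ not ∘ inN v) ⟨
      ∑[ i < order ] (𝟙 (inN v i) + 𝟙 (not (inN v i)))
        ≡⟨ sum-cong-≗ (𝟙-complement ∘ inN v) ⟩
      ∑[ i < order ] 1   ≡⟨ sum-const order 1 ⟩
      order * 1          ≡⟨ ℕ.*-identityʳ order ⟩
      order              ≡⟨ d+2≡n ⟨
      d + 2              ∎)
      where open ≡-Reasoning

    module _ (g : SignFunction) where
      private
        P = plusCount g
        σ⁺ : Fin order → ℕ
        σ⁺ i = [ Func.to g (from i) ]⁺

      -- `outsidePlus v` is the quantity m v of the opening outline.
      insidePlus outsidePlus : Vertex → ℕ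
      insidePlus  v = ∑[ i < order ] (𝟙 (inN v i) * σ⁺ i)
      outsidePlus v = ∑[ i < order ] (𝟙 (not (inN v i)) * σ⁺ i)

      inside+outside : ∀ v → insidePlus v + outsidePlus v ≡ P
      inside+outside v = trans
        (sym (∑-distrib-+ (λ i → 𝟙 (inN v i) * σ⁺ i) (λ i → 𝟙 (not (inN v i)) * σ⁺ i)))
        (sum-cong-≗ λ i → trans
          (sym (ℕ.*-distribʳ-+ (σ⁺ i) (𝟙 (inN v i)) (𝟙 (not (inN v i)))))
          (trans (cong (_* σ⁺ i) (𝟙-complement (inN v i))) (ℕ.*-identityˡ (σ⁺ i))))

      outsidePlus≤2 : ∀ v → outsidePlus v ≤ 2
      outsidePlus≤2 v = subst (outsidePlus v ≤_) (co-regular v)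
        (sum-mono-≤ λ i → subst (𝟙 (not (inN v i)) * σ⁺ i ≤_) (ℕ.*-identityʳ _)
          (ℕ.*-monoʳ-≤ (𝟙 (not (inN v i))) ([]⁺≤1 (Func.to g (from i)))))
        where
        []⁺≤1 : ∀ s → [ s ]⁺ ≤ 1
        []⁺≤1 Sign.+ = s≤s z≤n
        []⁺≤1 Sign.- = z≤n

      -- Double counting: a plus sign at `j` is counted once for each closed neighbourhood that
      -- misses `j`, and by symmetry there are two of these.
      sum-outsidePlus : ∑[ i < order ] outsidePlus (from i) ≡ 2 * P
      sum-outsidePlus = begin
        ∑[ i < order ] ∑[ j < order ] (𝟙 (not (inN (from i) j)) * σ⁺ j)
          ≡⟨ ∑-comm (λ i j → 𝟙 (not (inN (from i) j)) * σ⁺ j) ⟩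
        ∑[ j < order ] ∑[ i < order ] (𝟙 (not (inN (from i) j)) * σ⁺ j)
          ≡⟨ sum-cong-≗ (λ j → *-distribʳ-sum (σ⁺ j) (λ i → 𝟙 (not (inN (from i) j)))) ⟨
        ∑[ j < order ] ((∑[ i < order ] 𝟙 (not (inN (from i) j))) * σ⁺ j)
          ≡⟨ sum-cong-≗ (λ j → cong (_* σ⁺ j) (column j)) ⟩
        ∑[ j < order ] (2 * σ⁺ j)
          ≡⟨ *-distribˡ-sum 2 σ⁺ ⟨
        2 * P ∎
        where
        open ≡-Reasoning
        column : ∀ j → ∑[ i < order ] 𝟙 (not (inN (from i) j)) ≡ 2
        column j = trans (sum-cong-≗ λ i → cong (𝟙 ∘ not) (inN-sym i j))
                         (co-regular (from j))

      neighbourhoodSum-insidePlus : ∀ v →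
        closedNeighbourhoodSum g v ℤ.+ + d ≡ + (2 * insidePlus v)
      neighbourhoodSum-insidePlus v = trans
        (cong (λ z → closedNeighbourhoodSum g v ℤ.+ + z) (sym (regular v)))
        (signedSum (inN v) (λ i → Func.to g (from i)))

      dominating⇒d<2inside : IsSignedDominating g → ∀ v → d < 2 * insidePlus v
      dominating⇒d<2inside dom v = ℤ.drop‿+<+
        (subst (+ d ℤ.<_) (neighbourhoodSum-insidePlus v) (ℤ.+-monoˡ-< (+ d) (dom v)))

      d<2inside⇒dominating : (∀ v → d < 2 * insidePlus v) → IsSignedDominating g
      d<2inside⇒dominating h v = +-cancelʳ-<ℤ (+ d)
        (subst (+ d ℤ.<_) (sym (neighbourhoodSum-insidePlus v)) (ℤ.+<+ (h v)))

      2P≡inside+outside : ∀ v → 2 * P ≡ 2 * insidePlus v + 2 * outsidePlus v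
      2P≡inside+outside v = trans (cong (2 *_) (sym (inside+outside v)))
        (ℕ.*-distribˡ-+ 2 (insidePlus v) (outsidePlus v))

      -- Of `2 * P`, which is at least `d + 5`, the outside vertices account for at most 4, so at
      -- least `d + 1` remains inside.
      3+n≤2P⇒dominating : 3 + order ≤ 2 * P → IsSignedDominating g
      3+n≤2P⇒dominating 3+n≤2P = d<2inside⇒dominating λ v →
        ℕ.+-cancelʳ-≤ 4 (suc d) (2 * insidePlus v) (begin
          suc d + 4                              ≡⟨ shift d ⟩
          3 + (d + 2)                            ≡⟨ cong (_+_ 3) d+2≡n ⟩
          3 + order                              ≤⟨ 3+n≤2P ⟩
          2 * P                                  ≡⟨ 2P≡inside+outside v ⟩
          2 * insidePlus v + 2 * outsidePlus v
            ≤⟨ ℕ.+-monoʳ-≤ (2 * insidePlus v) (ℕ.*-monoʳ-≤ 2 (outsidePlus≤2 v)) ⟩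
          2 * insidePlus v + 4                   ∎)
        where
        open ℕ.≤-Reasoning
        shift : ∀ x → suc x + 4 ≡ 3 + (x + 2)
        shift = ℕSolver.solve-∀

      -- One descent step, applied with `t` equal to 1 and then 0. Domination puts at least `d + 1`
      -- of `2 * P` inside, so less than `2 * suc t` is left outside each neighbourhood; summing the
      -- bound `t` over all vertices gives the claim.
      averaging : IsSignedDominating g → ∀ t → 2 * P ≤ d + 2 * suc t → 2 * P ≤ order * t
      averaging dom t 2P≤ = subst₂ _≤_ sum-outsidePlus (sum-const order t)
        (sum-mono-≤ (outside≤t ∘ from))
        where
        open ℕ.≤-Reasoning
        outside≤t : ∀ v → outsidePlus v ≤ t
        outside≤t v = s≤s⁻¹ (ℕ.*-cancelˡ-< 2 (outsidePlus v) (suc t)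
          (ℕ.+-cancelˡ-≤ d _ _ (begin
            d + suc (2 * outsidePlus v)            ≡⟨ ℕ.+-suc d _ ⟩
            suc d + 2 * outsidePlus v
              ≤⟨ ℕ.+-monoˡ-≤ (2 * outsidePlus v) (dominating⇒d<2inside dom v) ⟩
            2 * insidePlus v + 2 * outsidePlus v   ≡⟨ 2P≡inside+outside v ⟨
            2 * P                                  ≤⟨ 2P≤ ⟩
            d + 2 * suc t                          ∎)))

      dominating⇒3+n≤2P : IsSignedDominating g → 3 + order ≤ 2 * P
      dominating⇒3+n≤2P dom = ℕ.≰⇒> λ 2P≤2+n →
        -- As `order` is `d + 2`, the output of the step with `t = 1` is exactly the input of the
        -- step with `t = 0`.
        let 2P≤d+4 = subst (2 * P ≤_)
              (trans (cong (_+_ 2) (sym d+2≡n)) (shift d)) 2P≤2+n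
            2P≤d+2 = subst (2 * P ≤_)
              (trans (ℕ.*-identityʳ order) (sym d+2≡n)) (averaging dom 1 2P≤d+4)
            2P≤0   = subst (2 * P ≤_) (ℕ.*-zeroʳ order) (averaging dom 0 2P≤d+2)
        in ℕ.<⇒≱ (begin-strict
             0                                     ≤⟨ z≤n ⟩
             d                                     <⟨ dominating⇒d<2inside dom v₀ ⟩
             2 * insidePlus v₀                     ≤⟨ ℕ.m≤m+n _ _ ⟩
             2 * insidePlus v₀ + 2 * outsidePlus v₀ ≡⟨ 2P≡inside+outside v₀ ⟨
             2 * P                                 ∎) 2P≤0
        where
        open ℕ.≤-Reasoning
        v₀ : Vertex
        -- The order `d + 2` is positive, so index `zero` exists.
        v₀ = from (subst Fin (trans (ℕ.+-comm 2 d) d+2≡n) zero)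
        shift : ∀ x → 2 + (x + 2) ≡ x + 4
        shift = ℕSolver.solve-∀

    -- The first two bounds and parity make `w` the least integer from 3 on with the parity of
    -- `order`. The minimum is attained with `h`, half of `w + order`, plus signs; `w ≤ order`
    -- ensures that there are enough vertices.
    signedDominationNumber : ∀ w → 3 ≤ w → w ≤ 4 → w ≤ order → 2 ∣ w + order →
      IsSignedDominationNumber Γ (+ w)
    signedDominationNumber w 3≤w w≤4 w≤n (divides h w+n≡h*2) =
      attained , lowerBound
      where
      open ℕ.≤-Reasoning

      w+n≡2h : w + order ≡ 2 * h
      w+n≡2h = trans w+n≡h*2 (ℕ.*-comm h 2)

      h≤n : h ≤ order
      h≤n = ℕ.*-cancelˡ-≤ 2 (begin
        2 * h          ≡⟨ w+n≡2h ⟨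
        w + order      ≤⟨ ℕ.+-monoˡ-≤ order w≤n ⟩
        order + order  ≡⟨ cong (_+_ order) (ℕ.+-identityʳ order) ⟨
        2 * order      ∎)

      attained : ∃ λ g → IsSignedDominating g × weight g ≡ + w
      attained with g , P≡h ← ∃-plusCount h≤n =
        let w+n≡2P = trans w+n≡2h (cong (2 *_) (sym P≡h)) in
        g ,
        3+n≤2P⇒dominating g (subst (3 + order ≤_) w+n≡2P (ℕ.+-monoˡ-≤ order 3≤w)) ,
        ℤ-cancelʳ (+ order) _ _ (trans (weight-plusCount g) (cong +_ (sym w+n≡2P)))
        where
        open GroupProperties (AbelianGroup.group ℤ.+-0-abelianGroup)
          using () renaming (∙-cancelʳ to ℤ-cancelʳ)

      lowerBound : ∀ g → IsSignedDominating g → + w ℤ.≤ weight g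
      lowerBound g dom = +-cancelʳ-≤ℤ (+ order)
        (subst (+ (w + order) ℤ.≤_) (sym (weight-plusCount g))
          (ℤ.+≤+ (subst (_≤ 2 * plusCount g) (sym w+n≡2h) (ℕ.*-monoʳ-≤ 2 h≤P))))
        where
        h≤P : h ≤ plusCount g
        -- For `w = 4` the bound `3 + order ≤ 2 * P` falls one short; evenness of `w + order` makes
        -- up for it, since `2 * h ≤ 2 * P + 1` already gives `h ≤ P`.
        h≤P = s≤s⁻¹ (ℕ.*-cancelˡ-< 2 h (suc (plusCount g)) (begin-strict
          2 * h                    ≡⟨ w+n≡2h ⟨
          w + order                ≤⟨ ℕ.+-monoˡ-≤ order w≤4 ⟩
          1 + (3 + order)          ≤⟨ s≤s (dominating⇒3+n≤2P g dom) ⟩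
          1 + 2 * plusCount g      <⟨ ℕ.n<1+n _ ⟩
          2 + 2 * plusCount g      ≡⟨ ℕ.*-suc 2 (plusCount g) ⟨
          2 * suc (plusCount g)    ∎))

-- Sizes of closed neighbourhoods in Cayley graphs.

module _ {c ℓ} (G : Group c ℓ) where
  open Group G hiding (refl) renaming (sym to ≈-sym; trans to ≈-trans)
  open GroupProperties G

  module _ {p} (n : ℕ) (|G|≡n : setoid HasCardinality n)
    (S : Pred Carrier p) (S-resp : S Respects _≈_)
    (ε∉S : ε ∉ S) (S≐S⁻¹ : S ≐ inverseSet G S)
    (k : ℕ) (|S|≡k : subsetoid setoid S HasCardinality k) where

    private
      Γ = Cay G |G|≡n S S-resp ε∉S S≐S⁻¹ |S|≡k
      open FiniteSimpleGraph Γ using (N[_]; _∈N[_]?)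
      module G = Inverse |G|≡n
      module S = Inverse |S|≡k

    Cay-regular : ∀ v → ∑[ i < n ] 𝟙 (inN Γ v i) ≡ suc k
    Cay-regular v = count-image (G.to ∘ translate ∘ quotient) injective
      (λ i → G.from i ∈N[ v ]?) image preimage
      where
      -- N[v] consists of the s⁻¹ v with s ∈ S ∪ {ε}.
      quotient : Fin (suc k) → Carrier
      quotient zero    = ε
      quotient (suc i) = proj₁ (S.from i)

      translate : Carrier → Carrier
      translate s = s ⁻¹ ∙ v

      quotient-injective : ∀ {i j} → quotient i ≈ quotient j → i ≡ j
      quotient-injective {zero}  {zero}  _  = refl
      quotient-injective {zero}  {suc j} eq =
        contradiction (S-resp (≈-sym eq) (proj₂ (S.from j))) ε∉S
      quotient-injective {suc i} {zero}  eq =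
        contradiction (S-resp eq (proj₂ (S.from i))) ε∉S
      -- Equality in `subsetoid` ignores membership proofs, so `eq` is already an equality of
      -- elements of the subset.
      quotient-injective {suc i} {suc j} eq = cong suc
        (trans (sym (S.strictlyInverseˡ i)) (trans (S.to-cong eq) (S.strictlyInverseˡ j)))

      to-injective : ∀ {x y} → G.to x ≡ G.to y → x ≈ y
      to-injective {x} {y} eq = ≈-trans (≈-sym (G.strictlyInverseʳ x))
        (≈-trans (G.from-cong eq) (G.strictlyInverseʳ y))

      injective : Injective _≡_ _≡_ (G.to ∘ translate ∘ quotient)
      injective = quotient-injective ∘ ⁻¹-injective ∘ ∙-cancelʳ v _ _ ∘ to-injective

      open import Relation.Binary.Reasoning.Setoid setoid

      -- Adjacency of `v` and `u` tests `v ∙ u ⁻¹`; for a translate this recovers `s`, so each `s`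
      -- in `S` yields a neighbour.
      translate-quotient : ∀ s → v ∙ translate s ⁻¹ ≈ s
      translate-quotient s = begin
        v ∙ (s ⁻¹ ∙ v) ⁻¹       ≈⟨ ∙-congˡ (⁻¹-anti-homo-∙ (s ⁻¹) v) ⟩
        v ∙ (v ⁻¹ ∙ s ⁻¹ ⁻¹)    ≈⟨ \\-leftDividesˡ v (s ⁻¹ ⁻¹) ⟩
        s ⁻¹ ⁻¹                 ≈⟨ ⁻¹-involutive s ⟩
        s                       ∎

      -- Gives surjectivity: a vertex of `N[ v ]` is the translate by its own adjacency quotient.
      translate-unique : ∀ {s u} → s ≈ v ∙ u ⁻¹ → translate s ≈ u
      translate-unique {s} {u} s≈vu⁻¹ = begin
        s ⁻¹ ∙ v             ≈⟨ ∙-congʳ (⁻¹-cong s≈vu⁻¹) ⟩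
        (v ∙ u ⁻¹) ⁻¹ ∙ v    ≈⟨ ∙-congʳ (⁻¹-anti-homo-// v u) ⟩
        (u ∙ v ⁻¹) ∙ v       ≈⟨ //-rightDividesˡ v u ⟩
        u                    ∎

      image : ∀ i → G.from (G.to (translate (quotient i))) ∈ N[ v ]
      image zero    = inj₁ (begin
        G.from (G.to (ε ⁻¹ ∙ v))  ≈⟨ G.strictlyInverseʳ _ ⟩
        ε ⁻¹ ∙ v                  ≈⟨ ∙-congʳ ε⁻¹≈ε ⟩
        ε ∙ v                     ≈⟨ identityˡ v ⟩
        v                         ∎)
      image (suc i) = inj₂ (S-resp (≈-sym (begin
        v ∙ G.from (G.to (translate s)) ⁻¹  ≈⟨ ∙-congˡ (⁻¹-cong (G.strictlyInverseʳ _)) ⟩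
        v ∙ translate s ⁻¹                  ≈⟨ translate-quotient s ⟩
        s                                   ∎)) (proj₂ (S.from i)))
        where s = proj₁ (S.from i)

      hit : ∀ i {j} → quotient i ≈ v ∙ G.from j ⁻¹ → G.to (translate (quotient i)) ≡ j
      hit i {j} eq = trans (G.to-cong (translate-unique eq)) (G.strictlyInverseˡ j)

      preimage : ∀ {j} → G.from j ∈ N[ v ] → ∃ λ i → G.to (translate (quotient i)) ≡ j
      preimage (inj₁ u≈v) =
        zero , hit zero (≈-sym (x≈y⇒x∙y⁻¹≈ε (≈-sym u≈v)))
      preimage (inj₂ vu⁻¹∈S) =
        suc i , hit (suc i) (S.strictlyInverseʳ (_ , vu⁻¹∈S))
        where i = S.to (_ , vu⁻¹∈S)

-- Parity and the two cases of the theorem.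

2∣n⊎2∣1+n : ∀ n → 2 ∣ n ⊎ 2 ∣ suc n
2∣n⊎2∣1+n zero    = inj₁ (2 ∣0)
2∣n⊎2∣1+n (suc n) = [ (λ 2∣n → inj₂ (∣m∣n⇒∣m+n ∣-refl 2∣n)) , inj₁ ]′ (2∣n⊎2∣1+n n)

theorem2p5 : ∀ {c ℓ p} (G : Group c ℓ) → let open Group G in
    (n : ℕ) (|G|≡n : setoid HasCardinality n)
    (S : Pred Carrier p) (S-resp : S Respects _≈_)
    (ε∉S : ε ∉ S) (S≐S⁻¹ : S ≐ inverseSet G S) → Generates G S →
    (k : ℕ) (|S|≡k : subsetoid setoid S HasCardinality k) → k + 3 ≡ n →
    let Γ = Cay G |G|≡n S S-resp ε∉S S≐S⁻¹ |S|≡k in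
    (2 ∤ n → IsSignedDominationNumber Γ (+ 3))
    × (2 ∣ n → IsSignedDominationNumber Γ (+ 4))
theorem2p5 G n |G|≡n S S-resp ε∉S S≐S⁻¹ _ k |S|≡k k+3≡n = odd , even
  where
  Γ = Cay G |G|≡n S S-resp ε∉S S≐S⁻¹ |S|≡k
  -- Here `d` is `suc k`: the connection set together with the vertex itself.
  open CoTwoRegular Γ (trans (sym (ℕ.+-suc k 2)) k+3≡n)
    (Cay-regular G n |G|≡n S S-resp ε∉S S≐S⁻¹ k |S|≡k)

  3≤n : 3 ≤ n
  3≤n = subst (3 ≤_) k+3≡n (ℕ.m≤n+m 3 k)

  odd : 2 ∤ n → IsSignedDominationNumber Γ (+ 3)
  odd 2∤n = signedDominationNumber 3 ℕ.≤-refl (ℕ.n≤1+n 3) 3≤n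
    -- For odd `n`, `3 + n` is 2 plus the even number `suc n`.
    ([ (λ 2∣n → contradiction 2∣n 2∤n) , ∣m∣n⇒∣m+n ∣-refl ]′ (2∣n⊎2∣1+n n))

  even : 2 ∣ n → IsSignedDominationNumber Γ (+ 4)
  even 2∣n = signedDominationNumber 4 (ℕ.n≤1+n 3) ℕ.≤-refl
    -- Evenness excludes `n = 3`, so there are at least four vertices.
    (ℕ.≤∧≢⇒< 3≤n λ { refl → from-no (2 ∣? 3) 2∣n })
    (∣m∣n⇒∣m+n (divides 2 refl) 2∣n)
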